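{- For graphs of odd girth at least $29$, there is a deterministic online coloring algorithm that uses $O(n^{2/5})$ colors, where $n$ is the number of vertices of the final graph.
   Context: Graphs are finite, simple and undirected. Online coloring problem: a graph $G=(V,E)$ is initially empty; vertices are added one by one, each together with its edges to previously added vertices. Immediately after a vertex $v$ is added, the algorithm must irrevocably assign a color $c(v)\in\mathbb{N}$ different from the colors of all neighbors of $v$; only then is the next vertex presented. The number of colors used is $|\{c(v): v\in V\}|$. The number $n$ of vertices of the final graph is assumed to be known to the algorithm in advance. An algorithm "for graphs of odd girth at least $29$" has to work on every online input whose final graph has odd girth at least $29$; the constant in $O(\cdot)$ is absolute. The odd girth of a graph is the length of its shortest odd-length cycle, or $+\infty$ if there is none (equivalently, the length of its shortest odd-length closed walk). -}

module Defs where

open import Data.Empty using (⊥)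
open import Data.Fin using (Fin; zero; suc)
open import Data.Fin.Subset using (Subset; _∈_)
open import Data.List using (List; _∷_; _∷ʳ_; length; deduplicate)
open import Data.List.Relation.Unary.Linked using (Linked)
open import Data.List.Relation.Unary.Unique.Propositional using (Unique)
open import Data.Nat using (ℕ; zero; suc; _≤_; _≟_)
open import Data.Nat.Divisibility using (_∣_)
open import Data.Vec using (Vec; []; _∷_; lookup; toList)
open import Level using (0ℓ)
open import Relation.Binary using (Rel; Symmetric; Irreflexive)
open import Relation.Binary.PropositionalEquality using (_≡_; _≢_; refl)
open import Relation.Nullary using (¬_)

record Graph (n : ℕ) : Set₁ where
  infix 4 _~_
  field
    _~_    : Rel (Fin n) 0ℓ
    sym    : Symmetric _~_
    irrefl : Irreflexive _≡_ _~_

module _ {n : ℕ} (G : Graph n) where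
  open Graph G

  -- The cycle v, v₁, …, vₘ, v, where vs = v₁, …, vₘ.
  record IsCycle (v : Fin n) (vs : List (Fin n)) : Set where
    field
      long     : 3 ≤ length (v ∷ vs)
      distinct : Unique (v ∷ vs)
      closed   : Linked _~_ (v ∷ (vs ∷ʳ v))

  -- Holds vacuously when there is no odd cycle (odd girth +∞).
  OddGirthAtLeast : ℕ → Set
  OddGirthAtLeast g = ∀ v vs → IsCycle v vs →
    ¬ (2 ∣ length (v ∷ vs)) → g ≤ length (v ∷ vs)

  Proper : Vec ℕ n → Set
  Proper c = ∀ i j → i ~ j → lookup c i ≢ lookup c j

-- A graph together with the order in which its vertices arrive: G ▷ N adds to
-- G one vertex whose neighbours among the vertices of G are exactly N.  The
-- newest vertex has index zero, and the indices of the older ones go up by one.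
infixl 5 _▷_
data OnlineGraph : ℕ → Set where
  ∅   : OnlineGraph 0
  _▷_ : ∀ {k} → OnlineGraph k → Subset k → OnlineGraph (suc k)

Adj : ∀ {n} → OnlineGraph n → Rel (Fin n) 0ℓ
Adj (G ▷ N) zero    zero    = ⊥
Adj (G ▷ N) zero    (suc j) = j ∈ N
Adj (G ▷ N) (suc i) zero    = i ∈ N
Adj (G ▷ N) (suc i) (suc j) = Adj G i j

Adj-sym : ∀ {n} (G : OnlineGraph n) → Symmetric (Adj G)
Adj-sym (G ▷ N) {zero}  {suc j} p = p
Adj-sym (G ▷ N) {suc i} {zero}  p = p
Adj-sym (G ▷ N) {suc i} {suc j} p = Adj-sym G p

Adj-irrefl : ∀ {n} (G : OnlineGraph n) → Irreflexive _≡_ (Adj G)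
Adj-irrefl (G ▷ N) {zero}  refl ()
Adj-irrefl (G ▷ N) {suc i} refl p = Adj-irrefl G refl p

graph : ∀ {n} → OnlineGraph n → Graph n
graph G = record { _~_ = Adj G ; sym = Adj-sym G ; irrefl = Adj-irrefl G }

-- The first argument is the number of vertices of the final graph.  The next
-- two are all that is known when the (k+1)-st vertex must be coloured: the
-- graph so far, including that vertex (index zero) and its edges, and the
-- colours already given to the k older vertices (newest first).
OnlineAlgorithm : Set
OnlineAlgorithm = ℕ → ∀ {k} → OnlineGraph (suc k) → Vec ℕ k → ℕ

run : OnlineAlgorithm → ℕ → ∀ {k} → OnlineGraph k → Vec ℕ k
run A n ∅       = []
run A n (G ▷ N) = let c = run A n G in A n (G ▷ N) c ∷ c

colouring : OnlineAlgorithm → ∀ {n} → OnlineGraph n → Vec ℕ n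
colouring A {n} G = run A n G

numColours : ∀ {n} → Vec ℕ n → ℕ
numColours c = length (deduplicate _≟_ (toList c))

{-# OPTIONS --safe #-}
module Submission where

-- With n ≈ s⁵ and K = s², First-Fit is run on K colours.  A vertex it rejects
-- has at least K older neighbours; it starts a cluster if these are disjoint
-- from the neighbourhoods of all earlier centres, and otherwise joins a cluster
-- whose centre is at distance 2.  So there are at most n/K = s³ clusters.
-- Two clusters are linked once an edge joins them; their centres then have a
-- walk of length 5 between them.
-- A cluster with fewer than s links keeps one colour until it gets a new link,
-- and then takes a colour that no linked cluster has ever used.  Such a cluster
-- uses at most s colours in its life, hence a palette of s · s colours suffices.
-- The clusters with at least s links are packed once more: those whose sets of
-- links are disjoint number at most s³/s = s², and any other one is grouped with
-- one of these, at walk distance 10.  An edge between two vertices of the same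
-- group would close a walk of length 2·(2 + 10) + 1 = 25.

open import Data.Nat using (ℕ; zero; suc; _+_; _*_; _^_; _≤_; _<_; z≤n; s≤s; _≟_; _≤?_; _<?_)
open import Data.Bool using (true; false)
open import Data.Empty using (⊥-elim)
open import Data.Fin using (Fin; zero; suc)
import Data.Fin
import Data.Fin.Subset as Sub
open import Data.List using (List; []; _∷_; _++_; _∷ʳ_; map; concat; foldr; length; mapMaybe; upTo)
open import Data.List.Properties using (length-++; length-map; length-upTo; length-++-sucʳ)
open import Data.List.Membership.DecPropositional _≟_ using (_∈?_)
open import Data.List.Membership.Propositional using (_∈_; _∉_; find; lose)
open import Data.List.Membership.Propositional.Properties
open import Data.List.Relation.Binary.Disjoint.Propositional using (Disjoint)
open import Data.List.Relation.Binary.Subset.Propositional using (_⊆_)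
open import Data.List.Relation.Unary.All as All using (All; []; _∷_)
open import Data.List.Relation.Unary.AllPairs using (AllPairs; []; _∷_)
open import Data.List.Relation.Unary.Any using (here; there; any?)
open import Data.List.Relation.Unary.Linked using (Linked; []; [-]; _∷_)
open import Data.List.Relation.Unary.Unique.Propositional using (Unique)
open import Data.List.Relation.Unary.Unique.Propositional.Properties using (concat⁺; upTo⁺)
open import Data.List.Relation.Unary.Unique.DecPropositional.Properties _≟_ using (deduplicate-!)
open import Data.Maybe using (Maybe; just; nothing)
open import Data.Maybe.Properties using (just-injective)
open import Data.Nat.Divisibility using (_∣_; _∣?_; divides)
open import Data.Nat.Properties hiding (_≟_; _≤?_; _<?_)
open import Data.Nat.Tactic.RingSolver using (solve-∀)
open import Data.Product using (Σ-syntax; ∃-syntax; _×_; _,_; proj₁; proj₂)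
open import Data.Sum using (_⊎_; inj₁; inj₂)
open import Data.Vec as Vec using (Vec; []; _∷_)
open import Function using (_∘_; id)
open import Relation.Binary.PropositionalEquality
open import Relation.Nullary using (¬_; Dec; yes; no; ¬?)
open import Relation.Nullary.Decidable using (from-yes; from-no)
open import Defs

private variable
  A B : Set
  m n d k : ℕ

-- Counting in lists, free colours and function updates.

private module Lists {A : Set} where

  length-⊆ : {xs ys : List A} → Unique xs → xs ⊆ ys → length xs ≤ length ys
  length-⊆ {[]} _ _ = z≤n
  length-⊆ {x ∷ xs} (x∉ ∷ u) sub with ∈-∃++ (sub (here refl))
  ... | ps , qs , refl = subst (suc (length xs) ≤_) (sym (length-++-sucʳ ps x qs))
          (s≤s (length-⊆ u λ {y} y∈ → drop-x y∈ (∈-++⁻ ps (sub (there y∈)))))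
    where
    drop-x : ∀ {y} → y ∈ xs → y ∈ ps ⊎ y ∈ x ∷ qs → y ∈ ps ++ qs
    drop-x y∈ (inj₁ p) = ∈-++⁺ˡ p
    drop-x y∈ (inj₂ (here refl)) = ⊥-elim (All.lookup x∉ y∈ refl)
    drop-x y∈ (inj₂ (there q)) = ∈-++⁺ʳ ps q

  length-concat-≤ : ∀ m (xss : List (List A)) → (∀ xs → xs ∈ xss → length xs ≤ m) →
    length (concat xss) ≤ length xss * m
  length-concat-≤ m [] _ = z≤n
  length-concat-≤ m (xs ∷ xss) h rewrite length-++ xs {concat xss} =
    +-mono-≤ (h xs (here refl)) (length-concat-≤ m xss λ ys → h ys ∘ there)

  length-concat-≥ : ∀ m (xss : List (List A)) → (∀ xs → xs ∈ xss → m ≤ length xs) →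
    length xss * m ≤ length (concat xss)
  length-concat-≥ m [] _ = z≤n
  length-concat-≥ m (xs ∷ xss) h rewrite length-++ xs {concat xss} =
    +-mono-≤ (h xs (here refl)) (length-concat-≥ m xss λ ys → h ys ∘ there)

  nonempty : {xs : List A} → 1 ≤ length xs → ∃[ x ] x ∈ xs
  nonempty {x ∷ _} _ = x , here refl

open Lists

∈-mapMaybe⁺ : ∀ (f : A → Maybe B) {x y xs} → x ∈ xs → f x ≡ just y → y ∈ mapMaybe f xs
∈-mapMaybe⁺ f {x} (here refl) eq with f x
∈-mapMaybe⁺ f {x} (here refl) refl | just _ = here refl
∈-mapMaybe⁺ f {xs = z ∷ _} (there p) eq with f z
... | just _ = there (∈-mapMaybe⁺ f p eq)
... | nothing = ∈-mapMaybe⁺ f p eq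

∈-mapMaybe⁻ : ∀ (f : A → Maybe B) {y} xs → y ∈ mapMaybe f xs → ∃[ x ] (x ∈ xs × f x ≡ just y)
∈-mapMaybe⁻ f (x ∷ xs) p with f x in eq
∈-mapMaybe⁻ f (x ∷ xs) (here refl) | just _ = x , here refl , eq
∈-mapMaybe⁻ f (x ∷ xs) (there p) | just _ = let (z , z∈ , e) = ∈-mapMaybe⁻ f xs p in z , there z∈ , e
... | nothing = let (z , z∈ , e) = ∈-mapMaybe⁻ f xs p in z , there z∈ , e

-- Used twice: a vertex rejected by First-Fit has at least `K` older neighbours, and fewer than `K`
-- forbidden colours leave one free in `pick`.
palette-full : ∀ m L → ¬ (∃[ c ] (c < m × c ∉ L)) → m ≤ length L
palette-full m L full = subst (_≤ length L) (length-upTo m) (length-⊆ (upTo⁺ m) sub)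
  where
  sub : upTo m ⊆ L
  sub {c} c∈ with c ∈? L
  ... | yes p = p
  ... | no c∉ = ⊥-elim (full (c , ∈-upTo⁻ c∈ , c∉))

unused? : ∀ m L → Dec (∃[ c ] (c < m × c ∉ L))
unused? m L = anyUpTo? (λ c → ¬? (c ∈? L)) m

infixl 20 _[_≔_]
_[_≔_] : (ℕ → A) → ℕ → A → ℕ → A
(f [ i ≔ a ]) j with j ≟ i
... | yes _ = a
... | no _  = f j

≔-same : ∀ (f : ℕ → A) i {a} → (f [ i ≔ a ]) i ≡ a
≔-same f i with i ≟ i
... | yes _ = refl
... | no ≢ = ⊥-elim (≢ refl)

≔-other : ∀ (f : ℕ → A) {i j a} → j ≢ i → (f [ i ≔ a ]) j ≡ f j
≔-other f {i} {j} ≢ with j ≟ i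
... | yes ≡ = ⊥-elim (≢ ≡)
... | no _ = refl

-- Walks of a given length.

data Walk (E : A → A → Set) : ℕ → A → A → Set where
  []  : ∀ {x} → Walk E 0 x x
  _∷_ : ∀ {x y z} → E x y → Walk E d y z → Walk E (suc d) x z

module _ {E : A → A → Set} where

  infixr 5 _⊕_
  _⊕_ : ∀ {x y z} → Walk E m x y → Walk E n y z → Walk E (m + n) x z
  [] ⊕ q = q
  (e ∷ p) ⊕ q = e ∷ (p ⊕ q)

  _▹_ : ∀ {x y z} → Walk E d x y → E y z → Walk E (suc d) x z
  [] ▹ e = e ∷ []
  (f ∷ p) ▹ e = f ∷ (p ▹ e)

  reverse : (∀ {x y} → E x y → E y x) → ∀ {x y} → Walk E d x y → Walk E d y x
  reverse s [] = []
  reverse s (e ∷ p) = reverse s p ▹ s e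

mapWalk : {E E′ : A → A → Set} → (∀ {x y} → E x y → E′ x y) → ∀ {x y} → Walk E d x y → Walk E′ d x y
mapWalk f [] = []
mapWalk f (e ∷ p) = f e ∷ mapWalk f p

-- Greedy packings of disjoint sets.

Family : Set
Family = List (ℕ × List ℕ)

labels : Family → List ℕ
labels = map proj₁

-- One step of a greedy maximal packing. The set of a centre is frozen when it enters: links that a
-- cluster gains later do not enlarge the set stored for its group.
assign : Family → ℕ → List ℕ → ℕ × Family
assign F v X with any? (λ p → any? (_∈? X) (proj₂ p)) F
... | yes q = proj₁ (proj₁ (find q)) , F
... | no _  = v , (v , X) ∷ F

record Assigned (F : Family) (v : ℕ) (X : List ℕ) (z : ℕ) (F′ : Family) : Set where
  field
    meets    : ∃[ M ] ((z , M) ∈ F′ × ∃[ y ] (y ∈ M × y ∈ X))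
    old      : F ⊆ F′
    new      : ∀ {p} → p ∈ F′ → p ∈ F ⊎ p ≡ (v , X)
    disjoint : AllPairs Disjoint (map proj₂ F) → AllPairs Disjoint (map proj₂ F′)

-- A set that opens a new entry meets itself, which is where nonemptiness enters; so in both cases
-- `X` has an element in common with the set of the returned centre.
assign-spec : ∀ F v X → 1 ≤ length X → let (z , F′) = assign F v X in Assigned F v X z F′
assign-spec F v X ne with any? (λ p → any? (_∈? X) (proj₂ p)) F
... | yes q = let (p , p∈ , h) = find q ; (y , y∈M , y∈X) = find h in record
  { meets = proj₂ p , p∈ , y , y∈M , y∈X
  ; old = id ; new = inj₁ ; disjoint = id }
... | no ¬q = record
  { meets = (let (y , y∈) = nonempty {xs = X} ne in X , here refl , y , y∈ , y∈)
  ; old = there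
  ; new = λ { (here refl) → inj₂ refl ; (there p) → inj₁ p }
  ; disjoint = All.tabulate (λ M∈ → apart (∈-map⁻ proj₂ M∈)) ∷_ }
  where
  apart : ∀ {M} → ∃[ p ] (p ∈ F × M ≡ proj₂ p) → Disjoint X M
  apart (p , p∈ , refl) (y∈X , y∈M) = ¬q (lose p∈ (lose y∈M y∈X))

record Packing (m : ℕ) (U : List ℕ) (F : Family) : Set where
  field
    member   : ∀ {z M} → (z , M) ∈ F → m ≤ length M × Unique M × M ⊆ U
    disjoint : AllPairs Disjoint (map proj₂ F)

-- The concatenation of disjoint duplicate-free sets is itself duplicate-free, so it is no longer
-- than `U`.
packing-bound : ∀ {m U F} → Packing m U F → length F * m ≤ length U
packing-bound {m} {U} {F} P = begin
  length F * m             ≡⟨ cong (_* m) (length-map proj₂ F) ⟨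
  length (map proj₂ F) * m ≤⟨ length-concat-≥ m _ (λ M M∈ → proj₁ (get M∈)) ⟩
  length (concat (map proj₂ F))
    ≤⟨ length-⊆ (concat⁺ (All.tabulate λ M∈ → proj₁ (proj₂ (get M∈))) disjoint)
                (λ x∈ → let (M , x∈M , M∈) = ∈-concat⁻′ _ x∈ in proj₂ (proj₂ (get M∈)) x∈M) ⟩
  length U ∎
  where
  open ≤-Reasoning
  open Packing P
  get : ∀ {M} → M ∈ map proj₂ F → m ≤ length M × Unique M × M ⊆ U
  get M∈ with ∈-map⁻ proj₂ M∈
  ... | (z , M) , p , refl = member p

packing-assign : ∀ {m U U′ F v X z F′} → U ⊆ U′ → m ≤ length X → Unique X → X ⊆ U′ →
  Assigned F v X z F′ → Packing m U F → Packing m U′ F′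
packing-assign U⊆ m≤ uX X⊆ as P = record
  { member = λ p → mem (new p) ; disjoint = Assigned.disjoint as (Packing.disjoint P) }
  where
  open Assigned as using (new)
  mem : ∀ {z M} → (z , M) ∈ _ ⊎ (z , M) ≡ _ → _
  mem (inj₁ p) = let (a , b , c) = Packing.member P p in a , b , λ x → U⊆ (c x)
  mem (inj₂ refl) = m≤ , uX , X⊆

packing-⊆ : ∀ {m U U′ F} → U ⊆ U′ → Packing m U F → Packing m U′ F
packing-⊆ U⊆ P = record
  { member = λ p → let (a , b , c) = Packing.member P p in a , b , λ x → U⊆ (c x)
  ; disjoint = Packing.disjoint P }

-- Links between clusters and the colours of lightly linked clusters.

-- For each cluster: the clusters linked to it, the colours it has used, and its
-- present colour, which is lost whenever a new link appears.
record Links : Set where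
  field
    nbrs : ℕ → List ℕ
    past : ℕ → List ℕ
    now  : ℕ → Maybe ℕ

open Links

-- A repeated link changes nothing, so each colour lost by a cluster can be charged to a link of its
-- own.
connect : ℕ → ℕ → Links → Links
connect a b Λ with b ∈? nbrs Λ a
... | yes _ = Λ
... | no _  = record Λ
  { nbrs = nbrs Λ [ a ≔ b ∷ nbrs Λ a ] [ b ≔ a ∷ nbrs Λ b ]
  ; now  = now Λ [ a ≔ nothing ] [ b ≔ nothing ] }

connectAll : ℕ → List ℕ → Links → Links
connectAll a bs Λ = foldr (connect a) Λ bs

module Algorithm (t : ℕ) where

  s K : ℕ
  s = suc t
  K = s * s

  pick : ℕ → Links → ℕ × Links
  pick a Λ with now Λ a
  ... | just γ = γ , Λ
  ... | nothing with unused? K (concat (map (past Λ) (nbrs Λ a)))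
  ...   | yes (γ , _) = γ , record Λ { past = past Λ [ a ≔ γ ∷ past Λ a ] ; now = now Λ [ a ≔ just γ ] }
  -- A default value; `pick-spec` shows that it is not reached while the cluster has fewer than `s`
  -- links.
  ...   | no _ = 0 , Λ

  current : Maybe ℕ → ℕ
  current nothing  = 0
  current (just _) = 1

  -- The property behind properness is `now-free`: a present colour must avoid whole pasts, because
  -- vertices keep the colours their cluster has since lost. The relation `R` later says that two
  -- centres are joined by a walk of length 5.
  record LinksInv (R : ℕ → ℕ → Set) (Λ : Links) : Set where
    field
      nbrs-sym    : ∀ {a b} → b ∈ nbrs Λ a → a ∈ nbrs Λ b
      nbrs-R      : ∀ {a b} → b ∈ nbrs Λ a → R a b
      nbrs-unique : ∀ a → Unique (nbrs Λ a)
      now-past    : ∀ a {γ} → now Λ a ≡ just γ → γ ∈ past Λ a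
      now-free    : ∀ a {b γ} → now Λ a ≡ just γ → b ∈ nbrs Λ a → γ ∉ past Λ b
      -- every colour but the present one was lost to a link of its own
      past-nbrs   : ∀ a → length (past Λ a) ≤ length (nbrs Λ a) + current (now Λ a)
      past-s      : ∀ a → length (past Λ a) ≤ s
      past-K      : ∀ a {γ} → γ ∈ past Λ a → γ < K

  open LinksInv

  mapLinksInv : ∀ {R R′ Λ} → (∀ {a b} → R a b → R′ a b) → LinksInv R Λ → LinksInv R′ Λ
  mapLinksInv f I = record
    { nbrs-sym = nbrs-sym I ; nbrs-R = λ b∈ → f (nbrs-R I b∈) ; nbrs-unique = nbrs-unique I
    ; now-past = now-past I ; now-free = now-free I ; past-nbrs = past-nbrs I
    ; past-s = past-s I ; past-K = past-K I }

  connect-past : ∀ a b Λ → past (connect a b Λ) ≡ past Λ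
  connect-past a b Λ with b ∈? nbrs Λ a
  ... | yes _ = refl
  ... | no _ = refl

  module Connect {R : ℕ → ℕ → Set} (irr : ∀ {a} → ¬ R a a) {a b} (Rab : R a b) (Rba : R b a) where

    private
      a≢b : a ≢ b
      a≢b refl = irr Rab

    connect-adds : ∀ Λ → b ∈ nbrs (connect a b Λ) a
    connect-adds Λ with b ∈? nbrs Λ a
    ... | yes p = p
    ... | no _ = subst (b ∈_) (sym (trans (≔-other _ a≢b) (≔-same (nbrs Λ) a))) (here refl)

    connect-keeps : ∀ Λ x {y} → y ∈ nbrs Λ x → y ∈ nbrs (connect a b Λ) x
    connect-keeps Λ x y∈ with b ∈? nbrs Λ a
    ... | yes _ = y∈
    ... | no _ with x ≟ b
    ...   | yes refl = there y∈
    ...   | no _ with x ≟ a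
    ...     | yes refl = there y∈
    ...     | no _ = y∈

    -- Both ends of a new link are left without a present colour, so `now-free` asks nothing of
    -- them; all other clusters keep their links.
    connect-inv : ∀ {Λ} → LinksInv R Λ → LinksInv R (connect a b Λ)
    connect-inv {Λ} I with b ∈? nbrs Λ a
    ... | yes _ = I
    ... | no b∉ = record
      { nbrs-sym = sym′ ; nbrs-R = R′ ; nbrs-unique = uniq′ ; now-past = λ x eq → now-past I x (proj₁ (now-old x eq))
      ; now-free = free′ ; past-nbrs = len′ ; past-s = past-s I ; past-K = past-K I }
      where
      nbrs′ = nbrs Λ [ a ≔ b ∷ nbrs Λ a ] [ b ≔ a ∷ nbrs Λ b ]
      now′ = now Λ [ a ≔ nothing ] [ b ≔ nothing ]

      data View (x : ℕ) : Set where
        at-b  : x ≡ b → nbrs′ x ≡ a ∷ nbrs Λ b → now′ x ≡ nothing → View x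
        at-a  : x ≡ a → nbrs′ x ≡ b ∷ nbrs Λ a → now′ x ≡ nothing → View x
        other : nbrs′ x ≡ nbrs Λ x → now′ x ≡ now Λ x → View x

      view : ∀ x → View x
      view x with x ≟ b in eq | x ≟ a in eq′
      ... | yes refl | _ = at-b refl (≔-same _ b) (≔-same _ b)
      ... | no x≢b | yes refl =
        at-a refl (trans (≔-other _ x≢b) (≔-same (nbrs Λ) a)) (trans (≔-other _ x≢b) (≔-same (now Λ) a))
      ... | no x≢b | no x≢a =
        other (trans (≔-other _ x≢b) (≔-other (nbrs Λ) x≢a)) (trans (≔-other _ x≢b) (≔-other (now Λ) x≢a))

      a∈ : a ∈ nbrs′ b
      a∈ = subst (a ∈_) (sym (≔-same _ b)) (here refl)

      b∈ : b ∈ nbrs′ a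
      b∈ = subst (b ∈_) (sym (trans (≔-other _ a≢b) (≔-same (nbrs Λ) a))) (here refl)

      keep : ∀ x {y} → y ∈ nbrs Λ x → y ∈ nbrs′ x
      keep x y∈ with view x
      ... | at-b refl eq _ rewrite eq = there y∈
      ... | at-a refl eq _ rewrite eq = there y∈
      ... | other eq _ rewrite eq = y∈

      sym′ : ∀ {x y} → y ∈ nbrs′ x → x ∈ nbrs′ y
      sym′ {x} {y} y∈ with view x
      ... | other eq _ rewrite eq = keep y (nbrs-sym I y∈)
      ... | at-b refl eq _ with subst (y ∈_) eq y∈
      ...   | here refl = b∈
      ...   | there p = keep y (nbrs-sym I p)
      sym′ {x} {y} y∈ | at-a refl eq _ with subst (y ∈_) eq y∈
      ...   | here refl = a∈
      ...   | there p = keep y (nbrs-sym I p)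

      R′ : ∀ {x y} → y ∈ nbrs′ x → R x y
      R′ {x} {y} y∈ with view x
      ... | other eq _ rewrite eq = nbrs-R I y∈
      ... | at-b refl eq _ with subst (y ∈_) eq y∈
      ...   | here refl = Rba
      ...   | there p = nbrs-R I p
      R′ {x} {y} y∈ | at-a refl eq _ with subst (y ∈_) eq y∈
      ...   | here refl = Rab
      ...   | there p = nbrs-R I p

      uniq′ : ∀ x → Unique (nbrs′ x)
      uniq′ x with view x
      ... | other eq _ rewrite eq = nbrs-unique I x
      ... | at-b refl eq _ rewrite eq = All.tabulate (λ { p refl → b∉ (nbrs-sym I p) }) ∷ nbrs-unique I b
      ... | at-a refl eq _ rewrite eq = All.tabulate (λ { p refl → b∉ p }) ∷ nbrs-unique I a

      now-old : ∀ x {γ} → now′ x ≡ just γ → now Λ x ≡ just γ × nbrs′ x ≡ nbrs Λ x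
      now-old x eq with view x
      ... | other eq₁ eq₂ = trans (sym eq₂) eq , eq₁
      ... | at-b _ _ eq₂ with () ← trans (sym eq₂) eq
      ... | at-a _ _ eq₂ with () ← trans (sym eq₂) eq

      free′ : ∀ x {y γ} → now′ x ≡ just γ → y ∈ nbrs′ x → γ ∉ past Λ y
      free′ x {y} eq y∈ = now-free I x (proj₁ (now-old x eq)) (subst (y ∈_) (proj₂ (now-old x eq)) y∈)

      -- The new link takes over the unit that the lost colour contributed through `current`.
      grow : ∀ x → length (past Λ x) ≤ suc (length (nbrs Λ x)) + 0
      grow x with now Λ x | past-nbrs I x
      ... | nothing | p = m≤n⇒m≤1+n p
      ... | just _ | p = subst (length (past Λ x) ≤_) (trans (+-suc _ 0) refl) p

      len′ : ∀ x → length (past Λ x) ≤ length (nbrs′ x) + current (now′ x)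
      len′ x with view x
      ... | other eq₁ eq₂ rewrite eq₁ | eq₂ = past-nbrs I x
      ... | at-b refl eq₁ eq₂ rewrite eq₁ | eq₂ = grow x
      ... | at-a refl eq₁ eq₂ rewrite eq₁ | eq₂ = grow x

  connectAll-past : ∀ a bs Λ → past (connectAll a bs Λ) ≡ past Λ
  connectAll-past a [] Λ = refl
  connectAll-past a (b ∷ bs) Λ = trans (connect-past a b (connectAll a bs Λ)) (connectAll-past a bs Λ)

  connectAll-inv : ∀ {R Λ} → (∀ {a} → ¬ R a a) → ∀ a bs → (∀ {b} → b ∈ bs → R a b × R b a) →
    LinksInv R Λ → LinksInv R (connectAll a bs Λ) × bs ⊆ nbrs (connectAll a bs Λ) a
  connectAll-inv irr a [] h I = I , λ ()
  connectAll-inv {R} {Λ} irr a (b ∷ bs) h I =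
    let (I′ , sub) = connectAll-inv {R} {Λ} irr a bs (λ p → h (there p)) I in
    connect-inv {connectAll a bs Λ} I′ , λ { (here refl) → connect-adds (connectAll a bs Λ)
                       ; (there p) → connect-keeps (connectAll a bs Λ) a (sub p) }
    where open Connect {R} irr (proj₁ (h (here refl))) (proj₂ (h (here refl)))

  record Picked (R : ℕ → ℕ → Set) (Λ : Links) (a γ : ℕ) (Λ′ : Links) : Set where
    field
      inv     : LinksInv R Λ′
      is-now  : now Λ′ a ≡ just γ
      nbrs-≡  : nbrs Λ′ ≡ nbrs Λ
      past-⊆  : ∀ b → past Λ b ⊆ past Λ′ b

  -- Fewer than `s` linked clusters with at most `s` past colours each forbid fewer than `s * s`
  -- colours, so one of the `K` is free.
  pick-spec : ∀ {R Λ} → (∀ {a} → ¬ R a a) → LinksInv R Λ → ∀ a → length (nbrs Λ a) < s →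
    let (γ , Λ′) = pick a Λ in Picked R Λ a γ Λ′
  pick-spec {R} {Λ} irr I a deg with now Λ a in eq
  ... | just γ = record { inv = I ; is-now = eq ; nbrs-≡ = refl ; past-⊆ = λ _ → id }
  ... | nothing with unused? K (concat (map (past Λ) (nbrs Λ a)))
  ...   | no full = ⊥-elim (<-irrefl refl (begin-strict
            K ≤⟨ palette-full K _ full ⟩
            length (concat (map (past Λ) (nbrs Λ a)))
              ≤⟨ length-concat-≤ s _ (λ xs p → short (∈-map⁻ (past Λ) p)) ⟩
            length (map (past Λ) (nbrs Λ a)) * s ≡⟨ cong (_* s) (length-map (past Λ) (nbrs Λ a)) ⟩
            length (nbrs Λ a) * s <⟨ *-monoˡ-< s deg ⟩
            K ∎))
    where
    open ≤-Reasoning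
    short : ∀ {xs} → ∃[ b ] (b ∈ nbrs Λ a × xs ≡ past Λ b) → length xs ≤ s
    short (b , _ , refl) = past-s I b
  ...   | yes (γ , γ<K , γ∉) = record
    { inv = record
      { nbrs-sym = nbrs-sym I ; nbrs-R = nbrs-R I ; nbrs-unique = nbrs-unique I
      ; now-past = now-past′ ; now-free = now-free′ ; past-nbrs = past-nbrs′
      ; past-s = past-s′ ; past-K = past-K′ }
    ; is-now = ≔-same (now Λ) a ; nbrs-≡ = refl ; past-⊆ = past-⊆′ }
    where
    past′ = past Λ [ a ≔ γ ∷ past Λ a ]
    now′ = now Λ [ a ≔ just γ ]

    γ-free : ∀ {b} → b ∈ nbrs Λ a → γ ∉ past Λ b
    γ-free b∈ γ∈ = γ∉ (∈-concat⁺′ γ∈ (∈-map⁺ (past Λ) b∈))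

    past-⊆′ : ∀ b → past Λ b ⊆ past′ b
    past-⊆′ b p with b ≟ a
    ... | yes refl = there p
    ... | no _ = p

    now-past′ : ∀ b {δ} → now′ b ≡ just δ → δ ∈ past′ b
    now-past′ b e with b ≟ a
    now-past′ b refl | yes refl = here refl
    ... | no _ = now-past I b e

    now-free′ : ∀ b {c δ} → now′ b ≡ just δ → c ∈ nbrs Λ b → δ ∉ past′ c
    now-free′ b {c} e c∈ δ∈ with b ≟ a | c ≟ a
    ... | yes refl | yes refl = irr (nbrs-R I c∈)
    now-free′ b refl c∈ δ∈ | yes refl | no _ = γ-free c∈ δ∈
    -- The colour just taken by `a` is not the present one of a linked `b`: by `now-past` that one
    -- lies in the past of `b`, which `γ` avoids.
    now-free′ b e c∈ (here refl) | no _ | yes refl = γ-free (nbrs-sym I c∈) (now-past I b e)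
    now-free′ b e c∈ (there δ∈) | no _ | yes refl = now-free I b e c∈ δ∈
    now-free′ b e c∈ δ∈ | no _ | no _ = now-free I b e c∈ δ∈

    -- With no present colour, all past colours were lost to links. There are fewer than `s` of
    -- these, which leaves room for one more colour.
    old-len : length (past Λ a) ≤ length (nbrs Λ a)
    old-len = subst (length (past Λ a) ≤_)
      (trans (cong (λ c → length (nbrs Λ a) + current c) eq) (+-identityʳ _)) (past-nbrs I a)

    past-nbrs′ : ∀ b → length (past′ b) ≤ length (nbrs Λ b) + current (now′ b)
    past-nbrs′ b with b ≟ a
    ... | no _ = past-nbrs I b
    ... | yes refl = subst (suc (length (past Λ a)) ≤_) (+-comm 1 _) (s≤s old-len)

    past-s′ : ∀ b → length (past′ b) ≤ s
    past-s′ b with b ≟ a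
    ... | no _ = past-s I b
    ... | yes refl = ≤-trans (s≤s old-len) deg

    past-K′ : ∀ b {δ} → δ ∈ past′ b → δ < K
    past-K′ b p with b ≟ a
    past-K′ b p | no _ = past-K I b p
    past-K′ b (here refl) | yes refl = γ<K
    past-K′ b (there p) | yes refl = past-K I b p

  -- The online algorithm.

  -- cl u is the cluster of u, or nothing if u was coloured by First-Fit.
  record State : Set where
    field
      col      : ℕ → ℕ
      cl       : ℕ → Maybe ℕ
      clusters : Family
      links    : Links
      supers   : Family

  open State

  start : State
  start = record
    -- The default 0 lies below `K`, so vertices that have not arrived satisfy the invariant for
    -- First-Fit vertices.
    { col = λ _ → 0 ; cl = λ _ → nothing ; clusters = []
    ; links = record { nbrs = λ _ → [] ; past = λ _ → [] ; now = λ _ → nothing } ; supers = [] }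

  -- Offsets 0, `K` and `K + K` separate the colours of First-Fit, of light clusters and of groups.
  -- As `z` is a vertex, the last range is sparse; what gets bounded is the number of centres `z`.
  settle : ℕ → ℕ → State → State
  settle v a σ with length (nbrs (links σ) a) <? s
  ... | yes _ = let (γ , Λ) = pick a (links σ) in
    record σ { links = Λ ; col = col σ [ v ≔ K + γ ] }
  ... | no _ = let (z , F) = assign (supers σ) a (nbrs (links σ) a) in
    record σ { supers = F ; col = col σ [ v ≔ K + K + z ] }

  -- The links to the clusters of all older neighbours enter before `settle` runs, so a light
  -- cluster's colour, kept or new, avoids all their pasts.
  join : ℕ → List ℕ → State → ℕ × State
  join v N σ = let (a , F) = assign (clusters σ) v N in a ,
    record σ { clusters = F ; links = connectAll a (mapMaybe (cl σ) N) (links σ) ; cl = cl σ [ v ≔ just a ] }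

  step : ℕ → List ℕ → State → State
  step v N σ with unused? K (map (col σ) N)
  ... | yes (c , _) = record σ { col = col σ [ v ≔ c ] ; cl = cl σ [ v ≔ nothing ] }
  ... | no _ = let (a , σ′) = join v N σ in settle v a σ′

  -- Irrevocability: a state recomputed at a later arrival still agrees with the colours already
  -- given.
  step-col : ∀ v N σ {x} → x ≢ v → col (step v N σ) x ≡ col σ x
  step-col v N σ x≢v with unused? K (map (col σ) N)
  ... | yes _ = ≔-other (col σ) x≢v
  ... | no _ with length (nbrs (links (proj₂ (join v N σ))) (proj₁ (join v N σ))) <? s
  ...   | yes _ = ≔-other (col σ) x≢v
  ...   | no _ = ≔-other (col σ) x≢v

  -- Invariants of the state.

  module _ (E : ℕ → ℕ → Set) where

    -- The walk excludes a link from a cluster to itself; the label places link sets inside the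
    -- universe of `super-pack`.
    Near : State → ℕ → ℕ → Set
    Near σ a b = Walk E 5 a b × b ∈ labels (clusters σ)

    -- The part of the invariant that holds already between `join` and `settle`, when the new vertex
    -- has a cluster but no colour.
    record Core (k : ℕ) (σ : State) : Set where
      field
        cl-walk       : ∀ {u a} → cl σ u ≡ just a → Walk E 2 u a
        cluster-pack  : Packing K (upTo k) (clusters σ)
        cluster-edge  : ∀ {a D x} → (a , D) ∈ clusters σ → x ∈ D → E a x
        cl-label      : ∀ {u a} → cl σ u ≡ just a → a ∈ labels (clusters σ)
        links-inv     : LinksInv (Near σ) (links σ)
        super-pack    : Packing s (labels (clusters σ)) (supers σ)
        super-walk    : ∀ {z M y} → (z , M) ∈ supers σ → y ∈ M → Walk E 5 z y

    Past Super : State → ℕ → ℕ → Set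
    Past σ u a = ∃[ γ ] (γ ∈ past (links σ) a × col σ u ≡ K + γ)
    Super σ u _ = ∃[ z ] (z ∈ labels (supers σ) × col σ u ≡ K + K + z × Walk E 12 u z)

    record Inv (k : ℕ) (σ : State) : Set where
      field
        core     : Core k σ
        free-col : ∀ {u} → cl σ u ≡ nothing → col σ u < K
        cl-col   : ∀ {u a} → cl σ u ≡ just a → Past σ u a ⊎ Super σ u a
        proper   : ∀ {x y} → E x y → col σ x ≢ col σ y

    -- Demanded of the newest vertex only: a later link may lead to a cluster whose past contains
    -- `γ`.
    FreshPast : State → ℕ → ℕ → Set
    FreshPast σ v a = ∃[ γ ] (γ ∈ past (links σ) a × col σ v ≡ K + γ ×
      (∀ {b} → b ∈ nbrs (links σ) a → γ ∉ past (links σ) b))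

    record Settled (k v a : ℕ) (σ σ′ : State) : Set where
      field
        core     : Core k σ′
        cl-≡     : cl σ′ ≡ cl σ
        nbrs-≡   : nbrs (links σ′) ≡ nbrs (links σ)
        col-old  : ∀ {x} → x ≢ v → col σ′ x ≡ col σ x
        past-⊆   : ∀ b → past (links σ) b ⊆ past (links σ′) b
        super-⊆  : labels (supers σ) ⊆ labels (supers σ′)
        colour   : FreshPast σ′ v a ⊎ Super σ′ v a

    settle-spec : (∀ {x y} → E x y → E y x) → (∀ {x} → ¬ Walk E 5 x x) → ∀ {k v a σ} →
      Core k σ → cl σ v ≡ just a → Settled k v a σ (settle v a σ)
    settle-spec E-sym no5 {k} {v} {a} {σ} C clv with length (nbrs (links σ) a) <? s
    ... | yes deg = record
      { core = record
        { cl-walk = cl-walk ; cluster-pack = cluster-pack ; cluster-edge = cluster-edge ; cl-label = cl-label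
        ; links-inv = P.inv ; super-pack = super-pack ; super-walk = super-walk }
      ; cl-≡ = refl ; nbrs-≡ = P.nbrs-≡ ; col-old = ≔-other (col σ) ; past-⊆ = P.past-⊆ ; super-⊆ = id
      ; colour = inj₁ (_ , now-past P.inv a P.is-now , ≔-same (col σ) v , now-free P.inv a P.is-now) }
      where
      open Core C
      module P = Picked (pick-spec (no5 ∘ proj₁) links-inv a deg)
    ... | no ¬deg = record
      { core = record
        { cl-walk = cl-walk ; cluster-pack = cluster-pack ; cluster-edge = cluster-edge ; cl-label = cl-label
        ; links-inv = links-inv
        ; super-pack = packing-assign id (≮⇒≥ ¬deg) (nbrs-unique links-inv a) (λ p → proj₂ (nbrs-R links-inv p)) as super-pack
        ; super-walk = λ p → walk′ (S.new p) }
      ; cl-≡ = refl ; nbrs-≡ = refl ; col-old = ≔-other (col σ) ; past-⊆ = λ _ → id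
      ; super-⊆ = label-⊆
      ; colour = inj₂ (_ , ∈-map⁺ proj₁ (proj₁ (proj₂ S.meets)) , ≔-same (col σ) v , walk₁₂ S.meets) }
      where
      open Core C
      as = assign-spec (supers σ) a (nbrs (links σ) a) (≤-trans (s≤s z≤n) (≮⇒≥ ¬deg))
      module S = Assigned as
      label-⊆ : labels (supers σ) ⊆ labels (proj₂ (assign (supers σ) a (nbrs (links σ) a)))
      label-⊆ z∈ with ∈-map⁻ proj₁ z∈
      ... | p , p∈ , refl = ∈-map⁺ proj₁ (S.old p∈)
      walk′ : ∀ {z M y} → (z , M) ∈ supers σ ⊎ (z , M) ≡ (a , nbrs (links σ) a) → y ∈ M → Walk E 5 z y
      walk′ (inj₁ p) y∈ = super-walk p y∈
      walk′ (inj₂ refl) y∈ = proj₁ (nbrs-R links-inv y∈)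
      walk₁₂ : ∀ {z} → ∃[ M ] ((z , M) ∈ _ × ∃[ y ] (y ∈ M × y ∈ nbrs (links σ) a)) → Walk E 12 v z
      walk₁₂ (M , p , y , y∈M , y∈a) =
        -- 12 = 2 + 5 + 5: to the centre `a`, on to a cluster `y` lying in both link sets, and back
        -- to the group centre.
        cl-walk clv ⊕ proj₁ (nbrs-R links-inv y∈a) ⊕ reverse E-sym (walk′ (S.new p) y∈M)

  -- Arrival of one vertex.

  record Extends (E E′ : ℕ → ℕ → Set) (v : ℕ) (N : List ℕ) : Set where
    field
      grow     : ∀ {x y} → E x y → E′ x y
      symm     : ∀ {x y} → E′ x y → E′ y x
      new      : ∀ {y} → y ∈ N → E′ v y
      split    : ∀ {x y} → E′ x y → E x y ⊎ (x ≡ v × y ∈ N) ⊎ (y ≡ v × x ∈ N)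
      old-<    : ∀ {x y} → E x y → x < v × y < v
      N-unique : Unique N
      N-<      : ∀ {y} → y ∈ N → y < v
      no5      : ∀ {x} → ¬ Walk E′ 5 x x
      no25     : ∀ {x} → ¬ Walk E′ 25 x x

  module Step {E E′ v N} (X : Extends E E′ v N) where
    open Extends X

    upTo-⊆ : upTo v ⊆ upTo (suc v)
    upTo-⊆ p = ∈-upTo⁺ (m≤n⇒m≤1+n (∈-upTo⁻ p))

    extend-core : ∀ {σ} → Core E v σ → Core E′ (suc v) σ
    extend-core C = record
      { cl-walk = λ e → mapWalk grow (cl-walk e) ; cluster-pack = packing-⊆ upTo-⊆ cluster-pack
      ; cluster-edge = λ p x∈ → grow (cluster-edge p x∈) ; cl-label = cl-label
      ; links-inv = mapLinksInv (λ { (w , b∈) → mapWalk grow w , b∈ }) links-inv ; super-pack = super-pack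
      ; super-walk = λ p y∈ → mapWalk grow (super-walk p y∈) }
      where open Core C

    -- Edges of `E` have both ends older than `v`, and only the colour of `v` is new.
    proper-step : ∀ {σ σ′} → Inv E v σ → (∀ {x} → x ≢ v → col σ′ x ≡ col σ x) →
      (∀ {w} → w ∈ N → col σ′ v ≢ col σ′ w) → ∀ {x y} → E′ x y → col σ′ x ≢ col σ′ y
    proper-step I old h e with split e
    ... | inj₁ e′ = λ eq → Inv.proper I e′
            (trans (sym (old (<⇒≢ (proj₁ (old-< e′))))) (trans eq (old (<⇒≢ (proj₂ (old-< e′))))))
    ... | inj₂ (inj₁ (refl , w∈)) = h w∈
    ... | inj₂ (inj₂ (refl , w∈)) = λ eq → h w∈ (sym eq)

    just≢nothing : ∀ {a : ℕ} → just a ≢ nothing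
    just≢nothing ()

    module Join {σ} (I : Inv E v σ) (K≤N : K ≤ length N) where
      open Inv I
      open Core core
      private
        a = proj₁ (join v N σ)
        σ₁ = proj₂ (join v N σ)
        bs = mapMaybe (cl σ) N
        as = assign-spec (clusters σ) v N (≤-trans (s≤s z≤n) K≤N)
        module S = Assigned as

      edge′ : ∀ {c D x} → (c , D) ∈ clusters σ₁ → x ∈ D → E′ c x
      edge′ p x∈ with S.new p
      ... | inj₁ q = grow (cluster-edge q x∈)
      ... | inj₂ refl = new x∈

      label-⊆ : labels (clusters σ) ⊆ labels (clusters σ₁)
      label-⊆ z∈ with ∈-map⁻ proj₁ z∈
      ... | p , p∈ , refl = ∈-map⁺ proj₁ (S.old p∈)

      a-label : a ∈ labels (clusters σ₁)
      a-label = ∈-map⁺ proj₁ (proj₁ (proj₂ S.meets))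

      walk-va : Walk E′ 2 v a
      -- The middle vertex `y` is a common neighbour of `v` and `a`. If `v` opens a cluster, then
      -- `a` is `v` and the walk goes to `y` and back.
      walk-va = let (D , p , y , y∈D , y∈N) = S.meets in new y∈N ∷ symm (edge′ p y∈D) ∷ []

      cl-v : cl σ₁ v ≡ just a
      cl-v = ≔-same (cl σ) v

      cl-view : ∀ u {c} → cl σ₁ u ≡ just c → (u ≡ v × c ≡ a) ⊎ (u ≢ v × cl σ u ≡ just c)
      cl-view u e with u ≟ v
      ... | yes refl = inj₁ (refl , sym (just-injective e))
      ... | no u≢v = inj₂ (u≢v , e)

      near : ∀ {b} → b ∈ bs → Near E′ σ₁ a b × Near E′ σ₁ b a
      near b∈ with ∈-mapMaybe⁻ (cl σ) N b∈
      ... | w , w∈ , e =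
        -- 5 = 2 + 1 + 2: from `a` to `v`, across the edge to `w`, and on to the centre of the
        -- cluster of `w`.
        let W = reverse symm walk-va ⊕ new w∈ ∷ mapWalk grow (cl-walk e) in
        (W , label-⊆ (cl-label e)) , reverse symm W , a-label

      linked : LinksInv (Near E′ σ₁) (links σ₁) × bs ⊆ nbrs (links σ₁) a
      linked = connectAll-inv (no5 ∘ proj₁) a bs near
        (mapLinksInv (λ { (w , b∈) → mapWalk grow w , label-⊆ b∈ }) links-inv)

      joined : Core E′ (suc v) σ₁
      joined = record
        { cl-walk = walk₂
        ; cluster-pack = packing-assign upTo-⊆ K≤N N-unique (λ y∈ → ∈-upTo⁺ (m≤n⇒m≤1+n (N-< y∈))) as cluster-pack
        ; cluster-edge = edge′ ; cl-label = λ {u} → lab {u} ; links-inv = proj₁ linked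
        ; super-pack = packing-⊆ label-⊆ super-pack
        ; super-walk = λ p y∈ → mapWalk grow (super-walk p y∈) }
        where
        walk₂ : ∀ {u c} → cl σ₁ u ≡ just c → Walk E′ 2 u c
        walk₂ {u} e with cl-view u e
        ... | inj₁ (refl , refl) = walk-va
        ... | inj₂ (_ , e′) = mapWalk grow (cl-walk e′)
        lab : ∀ {u c} → cl σ₁ u ≡ just c → c ∈ labels (clusters σ₁)
        lab {u} e with cl-view u e
        ... | inj₁ (refl , refl) = a-label
        ... | inj₂ (_ , e′) = label-⊆ (cl-label e′)

      private
        σ₂ = settle v a σ₁
        module T = Settled (settle-spec E′ symm no5 {suc v} {v} {a} {σ₁} joined cl-v)

      past-grow : ∀ b → past (links σ) b ⊆ past (links σ₂) b
      past-grow b {γ} γ∈ = T.past-⊆ b (subst (λ p → γ ∈ p b) (sym (connectAll-past a bs (links σ))) γ∈)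

      old-col : ∀ {u b} → u ≢ v → cl σ u ≡ just b → Past E′ σ₂ u b ⊎ Super E′ σ₂ u b
      old-col {u} {b} u≢v e with cl-col e
      ... | inj₁ (γ , γ∈ , eq) = inj₁ (γ , past-grow b γ∈ , trans (T.col-old u≢v) eq)
      ... | inj₂ (z , z∈ , eq , w) = inj₂ (z , T.super-⊆ z∈ , trans (T.col-old u≢v) eq , mapWalk grow w)

      new-col : Past E′ σ₂ v a ⊎ Super E′ σ₂ v a
      new-col with T.colour
      ... | inj₁ (γ , γ∈ , eq , _) = inj₁ (γ , γ∈ , eq)
      ... | inj₂ z = inj₂ z

      K≤col : ∀ {u b} → Past E′ σ₂ u b ⊎ Super E′ σ₂ u b → K ≤ col σ₂ u
      K≤col (inj₁ (γ , _ , eq)) = subst (K ≤_) (sym eq) (m≤m+n K γ)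
      K≤col (inj₂ (z , _ , eq , _)) =
        subst (K ≤_) (sym eq) (≤-trans (m≤m+n K K) (m≤m+n (K + K) z))

      past≢super : ∀ {x y b c} → Past E′ σ₂ x b → Super E′ σ₂ y c → col σ₂ x ≢ col σ₂ y
      past≢super {b = b} (γ , γ∈ , eq) (z , _ , eq′ , _) e = <⇒≢ lt (trans (sym eq) (trans e eq′))
        where
        lt : K + γ < K + K + z
        lt = ≤-trans (+-monoʳ-< K (past-K (Core.links-inv T.core) b γ∈)) (m≤m+n (K + K) z)

      -- First-Fit neighbours and mixed pairs are separated by the ranges. Two light colours differ
      -- because the clusters are linked and the colour of `v` avoids linked pasts. Equal group
      -- colours give a common group centre and close a walk of length 25 = 1 + 12 + 12.
      new≢nbr : ∀ {w} → w ∈ N → col σ₂ v ≢ col σ₂ w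
      new≢nbr {w} w∈ with cl σ w in e
      ... | nothing = λ eq → <-irrefl refl (≤-trans
              (subst (_< K) (trans (sym (T.col-old (<⇒≢ (N-< w∈)))) (sym eq)) (free-col e)) (K≤col {b = a} new-col))
      ... | just b with T.colour | old-col (<⇒≢ (N-< w∈)) e
      ...   | inj₁ (γ , _ , eq , γ-free) | inj₁ (δ , δ∈ , eq′) = λ e′ →
                γ-free (subst (λ f → b ∈ f a) (sym T.nbrs-≡) (proj₂ linked (∈-mapMaybe⁺ (cl σ) w∈ e)))
                  (subst (_∈ past (links σ₂) b) (sym (+-cancelˡ-≡ K γ δ (trans (sym eq) (trans e′ eq′)))) δ∈)
      ...   | inj₁ (γ , γ∈ , eq , _) | inj₂ S = past≢super {b = a} {b} (γ , γ∈ , eq) S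
      ...   | inj₂ S | inj₁ P = past≢super {b = b} {a} P S ∘ sym
      ...   | inj₂ (z , _ , eq , W) | inj₂ (z′ , _ , eq′ , W′) = λ e′ →
                no25 (close (+-cancelˡ-≡ (K + K) z z′ (trans (sym eq) (trans e′ eq′))) W W′)
        where
        close : ∀ {z z′} → z ≡ z′ → Walk E′ 12 v z → Walk E′ 12 w z′ → Walk E′ 25 v v
        close refl W W′ = new w∈ ∷ (W′ ⊕ reverse symm W)

      join-inv : Inv E′ (suc v) σ₂
      join-inv = record
        { core = T.core ; free-col = λ {u} → free {u} ; cl-col = λ {u} e → cl-col′ (trans (cong (λ f → f u) (sym T.cl-≡)) e)
        ; proper = proper-step {σ} {σ₂} I T.col-old new≢nbr }
        where
        free : ∀ {u} → cl σ₂ u ≡ nothing → col σ₂ u < K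
        free {u} e with u ≟ v
        ... | yes refl = ⊥-elim (just≢nothing (trans (sym cl-v) (trans (cong (λ f → f v) (sym T.cl-≡)) e)))
        ... | no u≢v = subst (_< K) (sym (T.col-old u≢v))
                (free-col (trans (sym (≔-other (cl σ) u≢v)) (trans (cong (λ f → f u) (sym T.cl-≡)) e)))
        cl-col′ : ∀ {u c} → cl σ₁ u ≡ just c → Past E′ σ₂ u c ⊎ Super E′ σ₂ u c
        cl-col′ {u} e with cl-view u e
        ... | inj₁ (refl , refl) = new-col
        ... | inj₂ (u≢v , e′) = old-col u≢v e′

    step-inv : ∀ {σ} → Inv E v σ → Inv E′ (suc v) (step v N σ)
    step-inv {σ} I with unused? K (map (col σ) N)
    ... | no full = Join.join-inv I (subst (K ≤_) (length-map (col σ) N) (palette-full K _ full))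
    ... | yes (c , c<K , c∉) = record
      { core = record
        { cl-walk = λ {u} e → cl-walk (proj₂ (cl-old u e)) ; cluster-pack = cluster-pack ; cluster-edge = cluster-edge
        ; cl-label = λ {u} e → cl-label (proj₂ (cl-old u e)) ; links-inv = links-inv
        ; super-pack = super-pack ; super-walk = super-walk }
      ; free-col = λ {u} → free {u} ; cl-col = λ {u} e → cl-col′ {u} (cl-old u e)
      ; proper = proper-step {σ} {σ′} I (≔-other (col σ)) new≢nbr }
      where
      open Inv I using (cl-col; free-col)
      open Core (extend-core (Inv.core I))
      σ′ = record σ { col = col σ [ v ≔ c ] ; cl = cl σ [ v ≔ nothing ] }

      cl-old : ∀ u {a} → cl σ′ u ≡ just a → u ≢ v × cl σ u ≡ just a
      cl-old u e with u ≟ v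
      ... | no u≢v = u≢v , e

      free : ∀ {u} → cl σ′ u ≡ nothing → col σ′ u < K
      free {u} e with u ≟ v
      ... | yes _ = c<K
      ... | no _ = free-col e

      cl-col′ : ∀ {u a} → u ≢ v × cl σ u ≡ just a → Past E′ σ′ u a ⊎ Super E′ σ′ u a
      cl-col′ (u≢v , e) with cl-col e
      ... | inj₁ (γ , γ∈ , eq) = inj₁ (γ , γ∈ , trans (≔-other (col σ) u≢v) eq)
      ... | inj₂ (z , z∈ , eq , w) = inj₂ (z , z∈ , trans (≔-other (col σ) u≢v) eq , mapWalk grow w)

      new≢nbr : ∀ {w} → w ∈ N → col σ′ v ≢ col σ′ w
      new≢nbr {w} w∈ eq = c∉ (subst (_∈ map (col σ) N)
        (trans (sym (≔-other (col σ) (<⇒≢ (N-< w∈)))) (trans (sym eq) (≔-same (col σ) v))) (∈-map⁺ (col σ) w∈))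

  start-inv : ∀ {E} → (∀ {x y} → ¬ E x y) → Inv E 0 start
  start-inv empty = record
    { core = record
      { cl-walk = λ () ; cluster-pack = record { member = λ () ; disjoint = [] } ; cluster-edge = λ ()
      ; cl-label = λ ()
      ; links-inv = record
        { nbrs-sym = λ () ; nbrs-R = λ () ; nbrs-unique = λ _ → [] ; now-past = λ _ () ; now-free = λ _ ()
        ; past-nbrs = λ _ → z≤n ; past-s = λ _ → z≤n ; past-K = λ _ () }
      ; super-pack = record { member = λ () ; disjoint = [] } ; super-walk = λ () }
    ; free-col = λ _ → s≤s z≤n ; cl-col = λ () ; proper = λ e → ⊥-elim (empty e) }

  -- Number of colours.

  palette : State → List ℕ
  palette σ = upTo (K + K) ++ map (K + K +_) (labels (supers σ))

  col∈palette : ∀ {E k σ} → Inv E k σ → ∀ u → col σ u ∈ palette σ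
  col∈palette {E} {k} {σ} I u with cl σ u in e
  ... | nothing = ∈-++⁺ˡ (∈-upTo⁺ (≤-trans (Inv.free-col I e) (m≤m+n K K)))
  ... | just a with Inv.cl-col I e
  ...   | inj₁ (γ , γ∈ , eq) = ∈-++⁺ˡ (∈-upTo⁺ (subst (_< K + K) (sym eq)
            (+-monoʳ-< K (past-K (Core.links-inv (Inv.core I)) a γ∈))))
  ...   | inj₂ (z , z∈ , eq , _) = ∈-++⁺ʳ (upTo (K + K)) (subst (_∈ _) (sym eq) (∈-map⁺ _ z∈))

  palette-bound : ∀ {E k σ} → Inv E k σ → k ≤ s ^ 5 → length (palette σ) ≤ 3 * K
  palette-bound {E} {k} {σ} I k≤ = begin
    length (palette σ) ≡⟨ length-++ (upTo (K + K)) ⟩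
    length (upTo (K + K)) + length (map (K + K +_) (labels (supers σ)))
      ≡⟨ cong₂ _+_ (length-upTo (K + K)) (trans (length-map _ (labels (supers σ))) (length-map proj₁ (supers σ))) ⟩
    K + K + Z          ≤⟨ +-monoʳ-≤ (K + K) Z≤K ⟩
    K + K + K          ≡⟨ thrice K ⟩
    3 * K              ∎
    where
    open ≤-Reasoning
    open Core (Inv.core I)
    Z = length (supers σ)
    thrice : ∀ x → x + x + x ≡ 3 * x
    thrice = solve-∀
    fifth : ∀ x → x * (x * (x * (x * (x * 1)))) ≡ x * x * (x * (x * x))
    fifth = solve-∀
    -- Both packings are used: `Z` groups need `Z * s` clusters, and these need `Z * s * K`
    -- vertices, at most `s ^ 5 = K * (s * K)`.
    Z≤K : Z ≤ K
    Z≤K = *-cancelʳ-≤ Z K (s * K) (begin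
      Z * (s * K) ≡⟨ *-assoc Z s K ⟨
      Z * s * K   ≤⟨ *-monoˡ-≤ K (packing-bound super-pack) ⟩
      length (labels (clusters σ)) * K ≡⟨ cong (_* K) (length-map proj₁ (clusters σ)) ⟩
      length (clusters σ) * K ≤⟨ packing-bound cluster-pack ⟩
      length (upTo k) ≡⟨ length-upTo k ⟩
      k           ≤⟨ k≤ ⟩
      s ^ 5       ≡⟨ fifth s ⟩
      K * (s * K) ∎)

-- Permanent vertex names and the run of the algorithm.

-- The number of older vertices: unlike the index, it never changes.
name : Fin k → ℕ
name {suc k} zero = k
name (suc i) = name i

name-< : (i : Fin k) → name i < k
name-< zero = ≤-refl
name-< (suc i) = m≤n⇒m≤1+n (name-< i)

name-injective : (i j : Fin k) → name i ≡ name j → i ≡ j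
name-injective zero zero _ = refl
name-injective zero (suc j) eq = ⊥-elim (<⇒≢ (name-< j) (sym eq))
name-injective (suc i) zero eq = ⊥-elim (<⇒≢ (name-< i) eq)
name-injective (suc i) (suc j) eq = cong suc (name-injective i j eq)

names : Sub.Subset k → List ℕ
names [] = []
names {suc k} (true ∷ N) = k ∷ names N
names (false ∷ N) = names N

∈-names⁺ : ∀ {N : Sub.Subset k} {i} → i Sub.∈ N → name i ∈ names N
∈-names⁺ {N = _ ∷ _} Vec.here = here refl
∈-names⁺ {N = true ∷ _} (Vec.there i∈) = there (∈-names⁺ i∈)
∈-names⁺ {N = false ∷ _} (Vec.there i∈) = ∈-names⁺ i∈

∈-names⁻ : ∀ (N : Sub.Subset k) {x} → x ∈ names N → ∃[ i ] (name i ≡ x × i Sub.∈ N)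
∈-names⁻ (true ∷ N) (here refl) = zero , refl , Vec.here
∈-names⁻ (true ∷ N) (there x∈) = let (i , eq , i∈) = ∈-names⁻ N x∈ in suc i , eq , Vec.there i∈
∈-names⁻ (false ∷ N) x∈ = let (i , eq , i∈) = ∈-names⁻ N x∈ in suc i , eq , Vec.there i∈

names-< : ∀ (N : Sub.Subset k) {x} → x ∈ names N → x < k
names-< N x∈ with ∈-names⁻ N x∈
... | i , refl , _ = name-< i

names-unique : (N : Sub.Subset k) → Unique (names N)
names-unique [] = []
names-unique (true ∷ N) = All.tabulate (λ x∈ eq → <⇒≢ (names-< N x∈) (sym eq)) ∷ names-unique N
names-unique (false ∷ N) = names-unique N

Edge : OnlineGraph k → ℕ → ℕ → Set
Edge G x y = ∃[ i ] ∃[ j ] (name i ≡ x × name j ≡ y × Adj G i j)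

edge-grow : (G : OnlineGraph k) (N : Sub.Subset k) → ∀ {x y} → Edge G x y → Edge (G ▷ N) x y
edge-grow G N (i , j , p , q , e) = suc i , suc j , p , q , e

-- Each `Edge` brings indices of its own; injectivity of `name` makes consecutive edges meet at the
-- same index.
lift-walk : (G : OnlineGraph k) → ∀ i {y} → Walk (Edge G) d (name i) y → ∃[ j ] (name j ≡ y × Walk (Adj G) d i j)
lift-walk G i [] = i , refl , []
lift-walk G i ((i′ , j , p , refl , e) ∷ w) with name-injective i′ i p | lift-walk G j w
... | refl | (l , eq , w′) = l , eq , e ∷ w′

NoClosedWalk : ℕ → OnlineGraph k → Set
NoClosedWalk d G = ∀ {x} → ¬ Walk (Edge G) d x x

module _ (t : ℕ) where
  open Algorithm t

  state : OnlineGraph k → State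
  state ∅ = start
  state {suc k} (G ▷ N) = step k (names N) (state G)

  state-inv : (G : OnlineGraph k) → NoClosedWalk 5 G → NoClosedWalk 25 G → Inv (Edge G) k (state G)
  state-inv ∅ _ _ = start-inv λ ()
  state-inv {suc k} (G ▷ N) no5 no25 = Step.step-inv extends
    (state-inv G (λ w → no5 (mapWalk (edge-grow G N) w)) (λ w → no25 (mapWalk (edge-grow G N) w)))
    where
    split′ : ∀ {x y} → Edge (G ▷ N) x y → Edge G x y ⊎ (x ≡ k × y ∈ names N) ⊎ (y ≡ k × x ∈ names N)
    split′ (zero , suc j , refl , refl , e) = inj₂ (inj₁ (refl , ∈-names⁺ e))
    split′ (suc i , zero , refl , refl , e) = inj₂ (inj₂ (refl , ∈-names⁺ e))
    split′ (suc i , suc j , p , q , e) = inj₁ (i , j , p , q , e)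

    extends : Extends (Edge G) (Edge (G ▷ N)) k (names N)
    extends = record
      { grow = edge-grow G N
      ; symm = λ { (i , j , p , q , e) → j , i , q , p , Adj-sym (G ▷ N) {i} {j} e }
      ; new = λ y∈ → let (j , eq , j∈) = ∈-names⁻ N y∈ in zero , suc j , refl , eq , j∈
      ; split = split′
      ; old-< = λ { (i , j , refl , refl , _) → name-< i , name-< j }
      ; N-unique = names-unique N ; N-< = names-< N ; no5 = no5 ; no25 = no25 }

open Algorithm.State using (col)

-- The state is a function of the graph, rebuilt at each arrival; the newest of `suc k` vertices has
-- name `k`.
algorithm : (ℕ → ℕ) → OnlineAlgorithm
algorithm f n {k} G _ = col (state (f n) G) k

run-colour : ∀ f n (G : OnlineGraph k) i → Vec.lookup (run (algorithm f) n G) i ≡ col (state (f n) G) (name i)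
run-colour f n (G ▷ N) zero = refl
run-colour f n (G ▷ N) (suc i) = trans (run-colour f n G i)
  (sym (Algorithm.step-col (f n) _ (names N) (state (f n) G) (<⇒≢ (name-< i))))

∈-toList : ∀ (c : Vec ℕ k) {x} → x ∈ Vec.toList c → ∃[ i ] Vec.lookup c i ≡ x
∈-toList (x ∷ c) (here refl) = zero , refl
∈-toList (_ ∷ c) (there x∈) = let (i , eq) = ∈-toList c x∈ in suc i , eq

numColours-≤ : ∀ (c : Vec ℕ k) (P : List ℕ) → (∀ i → Vec.lookup c i ∈ P) → numColours c ≤ length P
numColours-≤ c P h = length-⊆ (deduplicate-! (Vec.toList c)) λ x∈ →
  let (i , eq) = ∈-toList c (∈-deduplicate⁻ _≟_ (Vec.toList c) x∈) in subst (_∈ P) eq (h i)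

-- From odd girth to the absence of short odd closed walks.

module _ {n} (G : Graph n) where
  open Graph G
  open import Data.List.Membership.DecPropositional (Data.Fin._≟_ {n}) using () renaming (_∈?_ to _∈ᶠ?_)

  data Path : Fin n → List (Fin n) → Fin n → Set where
    []  : ∀ {x} → Path x [] x
    _∷_ : ∀ {x y vs z} → x ~ y → Path y vs z → Path x (y ∷ vs) z

  end∈ : ∀ {x y z vs} → Path x (y ∷ vs) z → z ∈ y ∷ vs
  end∈ (_ ∷ []) = here refl
  end∈ (_ ∷ (e ∷ p)) = there (end∈ (e ∷ p))

  -- The entering edge `w ~ x` is carried along so that, when `w` is `y`, the first part is already
  -- a closed cycle.
  split-path : ∀ {x y z w vs} → w ~ x → Path x vs z → y ∈ x ∷ vs →
    ∃[ ps ] ∃[ qs ] (x ∷ vs ≡ ps ++ y ∷ qs × Linked _~_ (w ∷ (ps ∷ʳ y)) × Path y qs z)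
  split-path e p (here refl) = [] , _ , refl , e ∷ [-] , p
  split-path {x} e (f ∷ p) (there y∈) =
    let (ps , qs , eq , l , q) = split-path f p y∈ in x ∷ ps , qs , cong (x ∷_) eq , e ∷ l , q

  unique-prefix : ∀ (ps : List (Fin n)) {y qs} → Unique (ps ++ y ∷ qs) → Unique (y ∷ ps)
  unique-prefix ps {y} u = All.tabulate (λ { x∈ refl → apart ps u x∈ }) ∷ pre ps u
    where
    apart : ∀ ps {qs} → Unique (ps ++ y ∷ qs) → y ∉ ps
    apart (p ∷ ps) (h ∷ _) (here refl) = All.lookup h (∈-++⁺ʳ ps (here refl)) refl
    apart (p ∷ ps) (_ ∷ u) (there y∈) = apart ps u y∈
    pre : ∀ ps {qs} → Unique (ps ++ y ∷ qs) → Unique ps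
    pre [] _ = []
    pre (p ∷ ps) (h ∷ u) = All.tabulate (λ x∈ → All.lookup h (∈-++⁺ˡ x∈)) ∷ pre ps u

  unique-suffix : ∀ (ps : List (Fin n)) {qs} → Unique (ps ++ qs) → Unique qs
  unique-suffix [] u = u
  unique-suffix (_ ∷ ps) (_ ∷ u) = unique-suffix ps u

  module _ {g} (girth : OddGirthAtLeast G g) where

    -- Closing an odd cycle would contradict the girth, so every cycle met while
    -- shortcutting the walk is even and the parity of its length is preserved.
    path-of-walk : ∀ {d x y} → Walk _~_ d x y → d < g →
      ∃[ vs ] ∃[ m ] (Path x vs y × Unique (x ∷ vs) × d ≡ length vs + m * 2)
    path-of-walk [] _ = [] , 0 , [] , [] ∷ [] , refl
    path-of-walk {suc d} {x} (e ∷ w) d<g with path-of-walk w (<-trans (n<1+n _) d<g)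
    ... | vs , m , p , u , eq with x ∈ᶠ? (_ ∷ vs)
    ...   | no x∉ = _ , m , e ∷ p , All.tabulate (λ { v∈ refl → x∉ v∈ }) ∷ u , cong suc eq
    ...   | yes x∈ with split-path e p x∈
    ...     | ps , qs , eq′ , l , q with 2 ∣? length (x ∷ ps)
    -- The walk returns to `x` along an even cycle, which is cut out; its length `t * 2` joins the
    -- even remainder.
    ...       | yes (divides t eqt) = qs , t + m , q , unique-suffix ps (subst Unique eq′ u) , (begin
                  suc d                                  ≡⟨ cong suc eq ⟩
                  suc (length vs) + m * 2                ≡⟨ cong (λ l → length l + m * 2) eq′ ⟩
                  length (ps ++ x ∷ qs) + m * 2          ≡⟨ cong (_+ m * 2) (trans (length-++-sucʳ ps x qs) (cong suc (length-++ ps))) ⟩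
                  length (x ∷ ps) + length qs + m * 2    ≡⟨ cong (λ l → l + length qs + m * 2) eqt ⟩
                  t * 2 + length qs + m * 2              ≡⟨ regroup t (length qs) m ⟩
                  length qs + (t + m) * 2                ∎)
      where
      open ≡-Reasoning
      regroup : ∀ a b c → a * 2 + b + c * 2 ≡ b + (a + c) * 2
      regroup = solve-∀
    -- An odd cycle found here is no longer than the walk, hence shorter than the girth.
    ...       | no odd = ⊥-elim (<⇒≱ d<g (≤-trans (girth x ps cycle odd) bound))
      where
      cycle : IsCycle G x ps
      cycle = record
        { long = long ps odd l
        ; distinct = unique-prefix ps {x} {qs} (subst Unique eq′ u)
        ; closed = l }
        where
        long : ∀ ps → ¬ (2 ∣ length (x ∷ ps)) → Linked _~_ (x ∷ (ps ∷ʳ x)) → 3 ≤ length (x ∷ ps)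
        long [] _ (e ∷ _) = ⊥-elim (irrefl refl e)
        long (_ ∷ []) odd _ = ⊥-elim (odd (divides 1 refl))
        long (_ ∷ _ ∷ _) _ _ = s≤s (s≤s (s≤s z≤n))
      bound : length (x ∷ ps) ≤ suc d
      bound = begin
        suc (length ps)                     ≤⟨ s≤s (m≤m+n (length ps) (length qs)) ⟩
        suc (length ps + length qs)         ≡⟨ trans (length-++-sucʳ ps x qs) (cong suc (length-++ ps)) ⟨
        length (ps ++ x ∷ qs)               ≡⟨ cong length eq′ ⟨
        suc (length vs)                     ≤⟨ s≤s (m≤m+n (length vs) (m * 2)) ⟩
        suc (length vs + m * 2)             ≡⟨ cong suc eq ⟨
        suc d                               ∎
        where open ≤-Reasoning

    -- A path without repetition that ends where it starts is empty, so the length of the walk is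
    -- its even remainder.
    no-odd-closed-walk : ∀ {d x} → ¬ (2 ∣ d) → d < g → ¬ Walk _~_ d x x
    no-odd-closed-walk odd d<g w with path-of-walk w d<g
    ... | [] , m , _ , _ , eq = odd (divides m eq)
    ... | _ ∷ _ , _ , p , (x∉ ∷ _) , _ = All.lookup x∉ (end∈ p) refl

noClosedWalk : ∀ {g d n} (G : OnlineGraph n) → OddGirthAtLeast (graph G) g → ¬ (2 ∣ d) → d < g → NoClosedWalk d G
noClosedWalk {d = suc _} G girth odd d<g w@((i , _ , refl , _) ∷ _) with lift-walk G i w
... | j , eq , w′ with name-injective j i eq
...   | refl = no-odd-closed-walk (graph G) girth odd d<g w′
noClosedWalk {d = zero} G girth odd d<g [] = odd (divides 0 refl)

-- Choice of `s` and the final bound.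

^-distribʳ-* : ∀ o m n → (m * n) ^ o ≡ m ^ o * n ^ o
^-distribʳ-* zero m n = refl
^-distribʳ-* (suc o) m n =
  trans (cong (m * n *_) (^-distribʳ-* o m n)) ([m*n]*[o*p]≡[m*o]*[n*p] m n (m ^ o) (n ^ o))

-- The base grows by one only when its fifth power has become too small. This at most doubles it,
-- whence the factor 32 = 2 ^ 5.
fifth-root : ∀ n → ∃[ t ] (suc n ≤ suc t ^ 5 × suc t ^ 5 ≤ 32 * suc n)
fifth-root zero = 0 , s≤s z≤n , s≤s z≤n
fifth-root (suc n) with fifth-root n
... | t , lo , hi with suc (suc n) ≤? suc t ^ 5
...   | yes lo′ = t , lo′ , ≤-trans hi (*-monoʳ-≤ 32 (n≤1+n (suc n)))
...   | no ¬lo′ = suc t , ≤-trans (s≤s lo) (^-monoˡ-< 5 (n<1+n (suc t))) , (begin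
          suc (suc t) ^ 5    ≤⟨ ^-monoˡ-≤ 5 (subst (suc (suc t) ≤_) (double t) (m≤m+n (suc (suc t)) t)) ⟩
          (2 * suc t) ^ 5    ≡⟨ ^-distribʳ-* 5 2 (suc t) ⟩
          32 * suc t ^ 5     ≤⟨ *-monoʳ-≤ 32 (≤-trans (≮⇒≥ ¬lo′) (n≤1+n (suc n))) ⟩
          32 * suc (suc n)   ∎)
  where
  open ≤-Reasoning
  double : ∀ t → suc (suc t) + t ≡ 2 * suc t
  double = solve-∀

root : ℕ → ℕ
-- An arbitrary value: the empty graph has no vertex to colour.
root zero = 0
root (suc n) = proj₁ (fifth-root n)

-- Fifth powers express the bound `C` times `n` to the power 2/5 within the natural numbers.
theorem19 : Σ[ A ∈ OnlineAlgorithm ] Σ[ C ∈ ℕ ]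
    ((n : ℕ) (G : OnlineGraph n) → OddGirthAtLeast (graph G) 29 →
    Proper (graph G) (colouring A G) ×
    numColours (colouring A G) ^ 5 ≤ C ^ 5 * n ^ 2)
-- 12 = 3 * 2 * 2: there are at most `3 * (s * s)` colours, and each `s` is at most twice the fifth
-- root of `n`.
theorem19 = algorithm root , 12 , works
  where
  works : (n : ℕ) (G : OnlineGraph n) → OddGirthAtLeast (graph G) 29 →
    Proper (graph G) (colouring (algorithm root) G) ×
    numColours (colouring (algorithm root) G) ^ 5 ≤ 12 ^ 5 * n ^ 2
  works zero ∅ _ = (λ ()) , z≤n
  works (suc n) G girth = proper′ , (begin
    numColours c ^ 5        ≤⟨ ^-monoˡ-≤ 5 (≤-trans (numColours-≤ c _ in-palette) (palette-bound inv (proj₁ bounds))) ⟩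
    (3 * (s * s)) ^ 5       ≡⟨ ^-distribʳ-* 5 3 (s * s) ⟩
    3 ^ 5 * (s * s) ^ 5     ≡⟨ cong (3 ^ 5 *_) (^-distribʳ-* 5 s s) ⟩
    3 ^ 5 * (s ^ 5 * s ^ 5) ≤⟨ *-monoʳ-≤ (3 ^ 5) (*-mono-≤ (proj₂ bounds) (proj₂ bounds)) ⟩
    3 ^ 5 * (32 * suc n * (32 * suc n)) ≡⟨ collect (3 ^ 5) 32 (suc n) ⟩
    12 ^ 5 * suc n ^ 2      ∎)
    where
    open ≤-Reasoning
    open Algorithm (root (suc n))
    bounds = proj₂ (fifth-root n)
    c = colouring (algorithm root) G
    inv = state-inv (root (suc n)) G (noClosedWalk G girth (from-no (2 ∣? 5)) (from-yes (5 <? 29)))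
                                     (noClosedWalk G girth (from-no (2 ∣? 25)) (from-yes (25 <? 29)))
    collect : ∀ a b m → a * (b * m * (b * m)) ≡ a * b * b * (m * (m * 1))
    collect = solve-∀
    in-palette : ∀ i → Vec.lookup c i ∈ palette (state (root (suc n)) G)
    in-palette i = subst (_∈ palette (state (root (suc n)) G)) (sym (run-colour root (suc n) G i)) (col∈palette inv (name i))
    proper′ : Proper (graph G) c
    proper′ i j e eq = Inv.proper inv (i , j , refl , refl , e)
      (trans (sym (run-colour root (suc n) G i)) (trans eq (run-colour root (suc n) G j)))
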